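{- For every integer $k\geq 2$, $$N(k)\leq\frac{1}{2}\binom{2k-2}{k-1}+n(k,k-2).$$
   Context: A family is a family of finite sets; its members are blocks, the elements of blocks are its points, and its point set is the union of its blocks. A blocking set of a family $\mathcal{F}$ is a set meeting every block; if a finite blocking set exists, a transversal is a blocking set of minimum size and $\mathcal{F}^{\top}$ is the family of all transversals. A family $\mathcal{F}$ is a maximal intersecting family of $k$-sets, an $MIF(k)$, if it has a finite blocking set, $\mathcal{F}=\mathcal{F}^{\top}$, and all its blocks have size $k$ (equivalently: a family of pairwise intersecting $k$-sets such that no $k$-set outside the family meets all its blocks). $N(k)$ denotes the maximum number of points of an $MIF(k)$. An intersecting set pair system with parameter $(k,t)$, an $ISP(k,t)$, is a collection $\{(A_i,B_i):1\le i\le n\}$ of pairs of finite sets with $\#A_i=k$, $\#B_i=t$ for all $i$, such that $A_i\cap B_j=\emptyset$ if and only if $i=j$; its point set is $\bigcup_i (A_i\cup B_i)$. $n(k,t)$ denotes the maximum number of points of an $ISP(k,t)$. (For $k=2$, $n(2,0)$ is understood with $t=0$, i.e. each $B_i=\emptyset$.) -}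

module Defs where

open import Data.Nat using (ℕ; _≟_)
open import Data.Fin using (Fin)
open import Data.List using (List; []; _∷_; length; concat; deduplicate; map; lookup; _++_)
open import Data.List.Relation.Unary.All using (All)
open import Data.List.Relation.Unary.Any using (Any)
open import Data.List.Relation.Unary.Unique.Propositional using (Unique)
open import Data.List.Membership.Propositional using (_∈_)
open import Data.List.Relation.Binary.Subset.Propositional using (_⊆_)
open import Data.Product using (_×_; ∃-syntax; proj₁; proj₂)
open import Relation.Binary.PropositionalEquality using (_≡_)
open import Relation.Nullary using (¬_)
open import Function.Bundles using (_⇔_)

-- Points are natural numbers; a finite set is a duplicate-free list of points.
FinSet : Set
FinSet = List ℕ

IsKSet : ℕ → FinSet → Set
IsKSet k S = Unique S × length S ≡ k

Meets : FinSet → FinSet → Set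
Meets A B = ∃[ x ] (x ∈ A × x ∈ B)

Disjoint : FinSet → FinSet → Set
Disjoint A B = ¬ Meets A B

SameSet : FinSet → FinSet → Set
SameSet A B = A ⊆ B × B ⊆ A

Family : Set
Family = List FinSet

numPoints : Family → ℕ
numPoints F = length (deduplicate _≟_ (concat F))

IsMIF : ℕ → Family → Set
IsMIF k F =
  All (IsKSet k) F ×
  (∀ {A B} → A ∈ F → B ∈ F → Meets A B) ×
  (∀ S → IsKSet k S → (∀ {B} → B ∈ F → Meets S B) → Any (SameSet S) F)

SPS : Set
SPS = List (FinSet × FinSet)

IsISP : ℕ → ℕ → SPS → Set
IsISP k t P =
  All (λ p → IsKSet k (proj₁ p) × IsKSet t (proj₂ p)) P ×
  (∀ (i j : Fin (length P)) →
     Disjoint (proj₁ (lookup P i)) (proj₂ (lookup P j)) ⇔ (i ≡ j))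

ispNumPoints : SPS → ℕ
ispNumPoints P = numPoints (map (λ p → proj₁ p ++ proj₂ p) P)

-- Call H ⊆ F critical if no (k − 2)-set blocks H, but some (k − 2)-set blocks H minus A for each
-- A ∈ H. The pairs of these A and blocking sets (padded by fresh points) form an ISP(k, k − 2)
-- whose points include ⋃ H. Every block of F blocks H, hence has at most one point outside ⋃ H.
-- For each x outside ⋃ H there are blocks A, B of F with A ∩ B = {x}, since A ∖ x is too small to
-- block F. The pairs (A ∖ x, B ∖ x) and (B ∖ x, A ∖ x) over all such x satisfy the hypotheses of
-- Bollobás' set-pairs inequality with parameters (k − 1, k − 1), which bounds twice the number of
-- points outside ⋃ H.

module Submission where

open import Defs
open import Data.Nat using (ℕ; zero; suc; pred; s≤s⁻¹; _≤_; _<_; _+_; _*_; _∸_; _!; z≤n; s≤s; _≟_)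
open import Data.Nat.Properties
open import Data.Nat.Combinatorics using (_C_; nCk≡n!/k![n-k]!; k![n∸k]!∣n!)
open import Data.Nat.DivMod using (m/n*n≡m)
open import Data.Nat.ListAction using (sum)
open import Data.Nat.Tactic.RingSolver using (solve-∀)
open import Data.Bool using (if_then_else_; true; false)
open import Data.Fin using (Fin; zero; suc)
import Data.Fin.Properties as Fin
open import Data.List using (List; []; _∷_; length; concat; deduplicate; filter; map; lookup; _++_; removeAt; tabulate; allFin)
open import Data.List.Properties using (length-tabulate; length-++; length-deduplicate; filter-notAll; length-removeAt; map-tabulate; tabulate-lookup)
open import Data.List.Relation.Unary.All as All using (All; []; _∷_)
import Data.List.Relation.Unary.All.Properties as All
open import Data.List.Relation.Unary.AllPairs as AllPairs using (AllPairs; []; _∷_)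
import Data.List.Relation.Unary.AllPairs.Properties as AllPairs
open import Data.List.Relation.Unary.Any as Any using (Any; here; there; any?; index)
import Data.List.Relation.Unary.Any.Properties as Any
open import Data.List.Relation.Unary.Unique.Propositional using (Unique)
open import Data.List.Relation.Unary.Unique.DecPropositional.Properties _≟_ using (deduplicate-!)
import Data.List.Relation.Unary.Unique.Propositional.Properties as Unique
open import Data.List.Membership.Propositional using (_∈_; _∉_; find; lose)
open import Data.List.Membership.Propositional.Properties
open import Data.List.Membership.DecPropositional _≟_ using (_∈?_)
open import Data.List.Relation.Binary.Subset.Propositional using (_⊆_)
open import Data.Product using (_×_; _,_; ∃-syntax; proj₁; proj₂; swap)
open import Data.Sum using (_⊎_; inj₁; inj₂; [_,_])
open import Function using (_∘_; id; mk⇔)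
open import Relation.Binary.PropositionalEquality using (_≡_; _≢_; refl; sym; trans; cong; cong₂; subst; module ≡-Reasoning)
open import Relation.Nullary using (¬_; Dec; yes; no; does; contradiction; ¬?)
open import Relation.Nullary.Decidable using (map′; decidable-stable)
open import Relation.Unary using (Decidable)

-- Positions, removal and cardinality in lists.

AllPairs-lookup : ∀ {A : Set} {R : A → A → Set} → (∀ {x y} → R x y → R y x) →
  ∀ {xs} → AllPairs R xs → ∀ {i j} → i ≢ j → R (lookup xs i) (lookup xs j)
AllPairs-lookup s (_ ∷ _) {zero} {zero} i≢j = contradiction refl i≢j
AllPairs-lookup s (r ∷ _) {zero} {suc j} _ = All.lookup r (∈-lookup j)
AllPairs-lookup s (r ∷ _) {suc i} {zero} _ = s (All.lookup r (∈-lookup i))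
AllPairs-lookup s (_ ∷ rs) {suc i} {suc j} i≢j = AllPairs-lookup s rs (i≢j ∘ cong suc)

Unique-⊆⇒length≤ : ∀ {A : Set} {xs ys : List A} → Unique xs → xs ⊆ ys → length xs ≤ length ys
Unique-⊆⇒length≤ {xs = xs} {ys} u xs⊆ys = ≮⇒≥ λ lt →
  let f = λ i → xs⊆ys (∈-lookup {xs = xs} i)
      (i , j , i<j , eq) = Fin.pigeonhole lt (index ∘ f)
  in AllPairs-lookup (_∘ sym) u (Fin.<⇒≢ i<j)
       (trans (Any.lookup-index (f i)) (trans (cong (lookup ys) eq) (sym (Any.lookup-index (f j)))))

∈-removeAt : ∀ {A : Set} (xs : List A) i j → i ≢ j → lookup xs j ∈ removeAt xs i
∈-removeAt (x ∷ xs) zero zero i≢j = contradiction refl i≢j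
∈-removeAt (x ∷ xs) zero (suc j) _ = ∈-lookup j
∈-removeAt (x ∷ xs@(_ ∷ _)) (suc i) zero _ = here refl
∈-removeAt (x ∷ xs@(_ ∷ _)) (suc i) (suc j) i≢j = there (∈-removeAt xs i j (i≢j ∘ cong suc))

removeAt-⊆ : ∀ {A : Set} (xs : List A) i → removeAt xs i ⊆ xs
removeAt-⊆ (x ∷ xs) zero p = there p
removeAt-⊆ (x ∷ xs@(_ ∷ _)) (suc i) (here p) = here p
removeAt-⊆ (x ∷ xs@(_ ∷ _)) (suc i) (there p) = there (removeAt-⊆ xs i p)

∈-removeAt-≢ : ∀ {A : Set} {xs : List A} {x} i → x ∈ xs → x ≢ lookup xs i → x ∈ removeAt xs i
∈-removeAt-≢ {xs = xs} i x∈ x≢ =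
  subst (_∈ removeAt xs i) (sym (Any.lookup-index x∈))
    (∈-removeAt xs i (index x∈) λ i≡j → x≢ (trans (Any.lookup-index x∈) (cong (lookup xs) (sym i≡j))))

-- Finite sums over lists.

∑ : ∀ {A : Set} → (A → ℕ) → List A → ℕ
∑ f xs = sum (map f xs)

∑-lookup : ∀ {A : Set} (f : A → ℕ) xs → ∑ (f ∘ lookup xs) (allFin (length xs)) ≡ ∑ f xs
∑-lookup f xs = cong sum (trans (map-tabulate id (f ∘ lookup xs))
  (trans (sym (map-tabulate (lookup xs) f)) (cong (map f) (tabulate-lookup xs))))

∑-removeAt : ∀ {A : Set} (f : A → ℕ) xs i → f (lookup xs i) + ∑ f (removeAt xs i) ≡ ∑ f xs
∑-removeAt f (x ∷ xs) zero = refl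
∑-removeAt f (x ∷ xs@(_ ∷ _)) (suc i) = begin
  f (lookup xs i) + (f x + s) ≡⟨ lemma (f (lookup xs i)) (f x) s ⟩
  f x + (f (lookup xs i) + s) ≡⟨ cong (f x +_) (∑-removeAt f xs i) ⟩
  f x + ∑ f xs ∎
  where
  open ≡-Reasoning
  s = ∑ f (removeAt xs i)
  lemma : ∀ a b c → a + (b + c) ≡ b + (a + c)
  lemma = solve-∀

∑-cong : ∀ {A : Set} {f g : A → ℕ} xs → (∀ x → f x ≡ g x) → ∑ f xs ≡ ∑ g xs
∑-cong [] _ = refl
∑-cong (x ∷ xs) eq = cong₂ _+_ (eq x) (∑-cong xs eq)

∑-+ : ∀ {A : Set} (f g : A → ℕ) xs → ∑ (λ x → f x + g x) xs ≡ ∑ f xs + ∑ g xs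
∑-+ f g [] = refl
∑-+ f g (x ∷ xs) rewrite ∑-+ f g xs = lemma (f x) (g x) (∑ f xs) (∑ g xs)
  where
  lemma : ∀ a b c d → a + b + (c + d) ≡ a + c + (b + d)
  lemma = solve-∀

∑-*ˡ : ∀ {A : Set} c (f : A → ℕ) xs → ∑ (λ x → c * f x) xs ≡ c * ∑ f xs
∑-*ˡ c f [] = sym (*-zeroʳ c)
∑-*ˡ c f (x ∷ xs) rewrite ∑-*ˡ c f xs = sym (*-distribˡ-+ c (f x) (∑ f xs))

∑-*ʳ : ∀ {A : Set} c (f : A → ℕ) xs → ∑ (λ x → f x * c) xs ≡ ∑ f xs * c
∑-*ʳ c f xs = trans (∑-cong xs (λ x → *-comm (f x) c)) (trans (∑-*ˡ c f xs) (*-comm c _))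

∑-const : ∀ {A : Set} c (xs : List A) → ∑ (λ _ → c) xs ≡ length xs * c
∑-const c [] = refl
∑-const c (x ∷ xs) = cong (c +_) (∑-const c xs)

∑-≤-const : ∀ {A : Set} {c} {f : A → ℕ} xs → (∀ x → f x ≤ c) → ∑ f xs ≤ length xs * c
∑-≤-const [] _ = z≤n
∑-≤-const (x ∷ xs) le = +-mono-≤ (le x) (∑-≤-const xs le)

∑-swap : ∀ {A B : Set} (f : A → B → ℕ) xs ys →
  ∑ (λ x → ∑ (f x) ys) xs ≡ ∑ (λ y → ∑ (λ x → f x y) xs) ys
∑-swap f [] ys = sym (trans (∑-const 0 ys) (*-zeroʳ (length ys)))
∑-swap f (x ∷ xs) ys rewrite ∑-swap f xs ys = sym (∑-+ (f x) _ ys)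

-- Turns the vanishing terms in `orderings` into the discarding of pairs, so that `∑-orderings-≤`
-- can recurse on the filtered list.
∑-filter : ∀ {A : Set} {P : A → Set} (P? : Decidable P) (f : A → ℕ) xs →
  ∑ (λ x → if does (P? x) then 0 else f x) xs ≡ ∑ f (filter (¬? ∘ P?) xs)
∑-filter P? f [] = refl
∑-filter P? f (x ∷ xs) with does (P? x)
... | true = ∑-filter P? f xs
... | false = cong (f x +_) (∑-filter P? f xs)

-- Bollobás' set-pairs inequality by counting orderings.

χ : FinSet → ℕ → ℕ
χ S x = if does (x ∈? S) then 1 else 0

χ-∈ : ∀ {S x} → x ∈ S → χ S x ≡ 1
χ-∈ {S} {x} x∈S with x ∈? S
... | yes _ = refl
... | no x∉S = contradiction x∈S x∉S

χ-∉ : ∀ {S x} → x ∉ S → χ S x ≡ 0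
χ-∉ {S} {x} x∉S with x ∈? S
... | yes x∈S = contradiction x∈S x∉S
... | no _ = refl

∑χ-disjoint : ∀ {S} X → ¬ Any (_∈ S) X → ∑ (χ S) X ≡ 0
∑χ-disjoint [] _ = refl
∑χ-disjoint (x ∷ X) ¬any = cong₂ _+_ (χ-∉ (¬any ∘ here)) (∑χ-disjoint X (¬any ∘ there))

∑χ-meets : ∀ {S X} → Any (_∈ S) X → ∃[ b ] ∑ (χ S) X ≡ suc b
∑χ-meets {S} {x ∷ X} (here x∈S) = _ , cong (_+ ∑ (χ S) X) (χ-∈ x∈S)
∑χ-meets {S} {x ∷ X} (there any) with b , eq ← ∑χ-meets any =
  χ S x + b , trans (cong (χ S x +_) eq) (+-suc (χ S x) b)

∑χ-filter : ∀ S X → ∑ (χ S) X ≡ length (filter (_∈? S) X)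
∑χ-filter S [] = refl
∑χ-filter S (x ∷ X) with does (x ∈? S)
... | true = cong suc (∑χ-filter S X)
... | false = ∑χ-filter S X

∑χ-⊆ : ∀ {S X} → Unique S → Unique X → S ⊆ X → ∑ (χ S) X ≡ length S
∑χ-⊆ {S} {X} uS uX S⊆X = trans (∑χ-filter S X) (≤-antisym
  (Unique-⊆⇒length≤ (Unique.filter⁺ (_∈? S) uX) (λ x∈ → proj₂ (∈-filter⁻ (_∈? S) {xs = X} x∈)))
  (Unique-⊆⇒length≤ uS λ x∈S → ∈-filter⁺ (_∈? S) (S⊆X x∈S) x∈S))

-- The number of orderings of the n points of X in which all of A precedes all of B, for A ⊆ X:
-- the last point is chosen outside A as long as points of B remain, then the rest is arbitrary.
orderings : ℕ → List ℕ → FinSet × FinSet → ℕ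
orderings zero X _ = 1
orderings (suc n) X (A , B) =
  if does (any? (_∈? B) X)
  then ∑ (λ i → if does (lookup X i ∈? A) then 0 else orderings n (removeAt X i) (A , B)) (allFin (length X))
  else suc n !

length-removeAt-suc : ∀ {A : Set} {xs : List A} {n} i → length xs ≡ suc n → length (removeAt xs i) ≡ n
length-removeAt-suc {xs = xs} i eq = trans (length-removeAt xs i) (cong pred eq)

length-allFin : ∀ n → length (allFin n) ≡ n
length-allFin n = length-tabulate id

-- Among the relative orders of the `a + b` points of `A` and `B` in `X`, the share
-- `a ! * b ! / (a + b) !` puts all of `A` first; the denominator is cleared here. The sizes are
-- sums of `χ` over `X` so that `∑-removeAt` tracks them when the last point is removed.
orderings-count : ∀ n X A B → Disjoint A B → length X ≡ n →
  ∀ a b → ∑ (χ A) X ≡ a → ∑ (χ B) X ≡ b → orderings n X (A , B) * (a + b) ! ≡ n ! * (a ! * b !)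
orderings-count zero [] A B _ _ a b refl refl = refl
orderings-count (suc n) X A B A∩B=∅ len a b ∑A ∑B with any? (_∈? B) X
... | no ¬any with refl ← trans (sym ∑B) (∑χ-disjoint X ¬any) =
  cong (suc n ! *_) (trans (cong _! (+-identityʳ a)) (sym (*-identityʳ (a !))))
... | yes any with b' , eq ← ∑χ-meets any with refl ← trans (sym ∑B) eq =
  +-cancelʳ-≡ (K * b * a) _ _ (begin
    ∑ h I * (a + b) ! + K * b * a
      ≡⟨ cong₂ _+_ (sym (∑-*ʳ ((a + b) !) h I)) (cong (K * b *_) (sym (trans (∑-lookup (χ A) X) ∑A))) ⟩
    ∑ (λ i → h i * (a + b) !) I + K * b * ∑ (χ A ∘ lookup X) I
      ≡⟨ cong (∑ (λ i → h i * (a + b) !) I +_) (sym (∑-*ˡ (K * b) _ I)) ⟩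
    ∑ (λ i → h i * (a + b) !) I + ∑ (λ i → K * b * χ A (lookup X i)) I
      ≡⟨ sym (∑-+ _ _ I) ⟩
    ∑ (λ i → h i * (a + b) ! + K * b * χ A (lookup X i)) I
      ≡⟨ ∑-cong I step ⟩
    ∑ (λ i → K * b + K * a * χ B (lookup X i)) I
      ≡⟨ ∑-+ _ _ I ⟩
    ∑ (λ _ → K * b) I + ∑ (λ i → K * a * χ B (lookup X i)) I
      ≡⟨ cong₂ _+_ (trans (∑-const _ I) (cong (_* (K * b)) (trans (length-allFin _) len)))
                   (trans (∑-*ˡ (K * a) _ I) (cong (K * a *_) (trans (∑-lookup (χ B) X) ∑B))) ⟩
    suc n * (K * b) + K * a * b
      ≡⟨ rearrange (suc n) (n !) (a !) (b' !) a b ⟩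
    suc n ! * (a ! * b !) + K * b * a ∎)
  where
  open ≡-Reasoning
  I = allFin (length X)
  -- The value given by the induction hypothesis when the last point is taken from `B`; `K * b` is
  -- its value when that point lies outside both sets.
  K = n ! * (a ! * b' !)
  h : Fin (length X) → ℕ
  h i = if does (lookup X i ∈? A) then 0 else orderings n (removeAt X i) (A , B)
  rearrange : ∀ s n a! b! a b → s * (n * (a! * b!) * b) + n * (a! * b!) * a * b
    ≡ s * n * (a! * (b * b!)) + n * (a! * b!) * b * a
  rearrange = solve-∀
  ih : ∀ i a b → ∑ (χ A) (removeAt X i) ≡ a → ∑ (χ B) (removeAt X i) ≡ b → _
  ih i = orderings-count n (removeAt X i) A B A∩B=∅ (length-removeAt-suc {xs = X} i len)
  ∑A-rest : ∀ i → χ A (lookup X i) ≡ 0 → ∑ (χ A) (removeAt X i) ≡ a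
  ∑A-rest i eq0 = trans (cong (_+ ∑ (χ A) (removeAt X i)) (sym eq0)) (trans (∑-removeAt (χ A) X i) ∑A)
  ∑B-rest : ∀ i → χ B (lookup X i) + ∑ (χ B) (removeAt X i) ≡ suc b'
  ∑B-rest i = trans (∑-removeAt (χ B) X i) ∑B
  -- The terms with χ A and χ B avoid subtraction: h i * (a + b)! is K * b off A ∪ B, K * (a + b) on B.
  step : ∀ i → h i * (a + b) ! + K * b * χ A (lookup X i) ≡ K * b + K * a * χ B (lookup X i)
  step i with lookup X i ∈? A | lookup X i ∈? B
  ... | yes x∈A | yes x∈B = contradiction (_ , x∈A , x∈B) A∩B=∅
  ... | yes x∈A | no x∉B = yes-no (K * b) (K * a)
    where
    yes-no : ∀ x y → x * 1 ≡ x + y * 0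
    yes-no = solve-∀
  ... | no x∉A | yes x∈B = begin
    w * (a + suc b') ! + K * b * 0 ≡⟨ cong (λ m → w * m ! + K * b * 0) (+-suc a b') ⟩
    w * (suc (a + b') * (a + b') !) + K * b * 0 ≡⟨ no-yes₁ w (suc (a + b')) ((a + b') !) (K * b) ⟩
    suc (a + b') * (w * (a + b') !)
      ≡⟨ cong (suc (a + b') *_) (ih i a b' (∑A-rest i (χ-∉ x∉A))
           (suc-injective (trans (cong (_+ ∑ (χ B) (removeAt X i)) (sym (χ-∈ x∈B))) (∑B-rest i)))) ⟩
    suc (a + b') * K ≡⟨ no-yes₂ a b' K ⟩
    K * b + K * a * 1 ∎
    where
    w = orderings n (removeAt X i) (A , B)
    no-yes₁ : ∀ w s f z → w * (s * f) + z * 0 ≡ s * (w * f)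
    no-yes₁ = solve-∀
    no-yes₂ : ∀ a b k → suc (a + b) * k ≡ k * suc b + k * a * 1
    no-yes₂ = solve-∀
  ... | no x∉A | no x∉B = begin
    w * (a + b) ! + K * b * 0
      ≡⟨ cong (_+ K * b * 0) (ih i a b (∑A-rest i (χ-∉ x∉A))
           (trans (cong (_+ ∑ (χ B) (removeAt X i)) (sym (χ-∉ x∉B))) (∑B-rest i))) ⟩
    n ! * (a ! * b !) + K * b * 0 ≡⟨ no-no (n !) (a !) b (b' !) (K * b) (K * a) ⟩
    K * b + K * a * 0 ∎
    where
    w = orderings n (removeAt X i) (A , B)
    no-no : ∀ n a! b b! x y → n * (a! * (b * b!)) + x * 0 ≡ n * (a! * b!) * b + y * 0
    no-no = solve-∀

-- Both directions are demanded because `AllPairs` sees each two entries in one order only.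
Cross : FinSet × FinSet → FinSet × FinSet → Set
Cross (A , B) (A' , B') = Meets A B' × Meets A' B

-- By crossing, no ordering is counted for two pairs: the induction fixes the last point x, which
-- leaves the pairs with x ∉ A.
∑-orderings-≤ : ∀ n X P → length X ≡ n → All (λ p → proj₁ p ⊆ X) P → AllPairs Cross P →
  ∑ (orderings n X) P ≤ n !
∑-orderings-≤ n X [] _ _ _ = z≤n
∑-orderings-≤ zero X (p ∷ []) _ _ _ = s≤s z≤n
-- Two crossing pairs need a common point in the first set of `p`, hence in `X`, which is empty
-- here.
∑-orderings-≤ zero X (p ∷ q ∷ P) len (A⊆X ∷ _) ((((_ , x∈A , _) , _) ∷ _) ∷ _) =
  contradiction (sym len) (<⇒≢ (∈-length (A⊆X x∈A)))
∑-orderings-≤ (suc n) X P@(_ ∷ _) len A⊆X cross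
  -- The sum over the last point is available only for pairs whose `B` still has a point in `X`;
  -- otherwise `orderings` has switched to its factorial case.
  with All.all? (λ p → any? (_∈? proj₂ p) X) P
... | yes B∩X = begin
  ∑ (orderings (suc n) X) P
    ≡⟨ ∑-cong-∈ B∩X ⟩
  ∑ (λ p → ∑ (w p) I) P
    ≡⟨ ∑-swap w P I ⟩
  ∑ (λ i → ∑ (λ p → w p i) P) I
    ≤⟨ ∑-≤-const I bound ⟩
  length I * n !
    ≡⟨ cong (_* n !) (trans (length-allFin _) len) ⟩
  suc n ! ∎
  where
  open ≤-Reasoning
  I = allFin (length X)
  w : FinSet × FinSet → Fin (length X) → ℕ
  w p i = if does (lookup X i ∈? proj₁ p) then 0 else orderings n (removeAt X i) p
  ∑-cong-∈ : ∀ {Q} → All (λ p → Any (_∈ proj₂ p) X) Q → ∑ (orderings (suc n) X) Q ≡ ∑ (λ p → ∑ (w p) I) Q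
  ∑-cong-∈ [] = refl
  ∑-cong-∈ {(A , B) ∷ Q} (m ∷ ms) with any? (_∈? B) X
  ... | yes _ = cong (∑ (w (A , B)) I +_) (∑-cong-∈ ms)
  ... | no ¬m = contradiction m ¬m
  bound : ∀ i → ∑ (λ p → w p i) P ≤ n !
  bound i = begin
    ∑ (λ p → w p i) P ≡⟨ ∑-filter (λ p → lookup X i ∈? proj₁ p) (orderings n (removeAt X i)) P ⟩
    ∑ (orderings n (removeAt X i)) (filter keep? P)
      ≤⟨ ∑-orderings-≤ n (removeAt X i) (filter keep? P) (length-removeAt-suc {xs = X} i len)
           (All.zipWith (λ (x∉A , A⊆X) {y} y∈A → ∈-removeAt-≢ i (A⊆X y∈A) λ { refl → x∉A y∈A })
             (All.all-filter keep? P , All.filter⁺ keep? A⊆X))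
           (AllPairs.filter⁺ keep? cross) ⟩
    n ! ∎
    where
    keep? : Decidable (λ p → ¬ lookup X i ∈ proj₁ p)
    keep? p = ¬? (lookup X i ∈? proj₁ p)
-- Some `B` misses `X`. Only a lone pair can do this, and it takes all `suc n !` orderings. With a
-- second pair, crossing gives every `B` a point of another pair's first set, hence a point in `X`.
∑-orderings-≤ (suc n) X ((A , B) ∷ []) len A⊆X cross | no ¬B∩X with any? (_∈? B) X
... | yes m = contradiction (m ∷ []) ¬B∩X
... | no _ = ≤-reflexive (+-identityʳ _)
∑-orderings-≤ (suc n) X (_ ∷ _ ∷ _) len (A⊆X ∷ A'⊆X ∷ _) ((c@(_ , _ , x∈A' , x∈B) ∷ cs) ∷ _) | no ¬B∩X =
  contradiction (lose (A'⊆X x∈A') x∈B ∷ All.map (λ ((_ , y∈A , y∈B') , _) → lose (A⊆X y∈A) y∈B') (c ∷ cs)) ¬B∩X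

[a+b]Ca*a!*b!≡[a+b]! : ∀ a b → ((a + b) C a) * (a ! * b !) ≡ (a + b) !
[a+b]Ca*a!*b!≡[a+b]! a b = begin
  ((a + b) C a) * (a ! * b !)
    ≡⟨ cong (λ c → ((a + b) C a) * (a ! * c !)) (sym (m+n∸m≡n a b)) ⟩
  ((a + b) C a) * (a ! * (a + b ∸ a) !)
    ≡⟨ cong (_* (a ! * (a + b ∸ a) !)) (nCk≡n!/k![n-k]! (m≤m+n a b)) ⟩
  _ ≡⟨ m/n*n≡m {{a !* (a + b ∸ a) !≢0}} (k![n∸k]!∣n! (m≤m+n a b)) ⟩
  (a + b) ! ∎
  where open ≡-Reasoning

-- Each pair accounts for exactly `n ! * (a ! * b !) / (a + b) !` orderings of the `n` points, and
-- all pairs together account for at most `n !`.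
bollobás : ∀ a b P →
  All (λ p → IsKSet a (proj₁ p) × IsKSet b (proj₂ p) × Disjoint (proj₁ p) (proj₂ p)) P →
  AllPairs Cross P → length P ≤ (a + b) C a
bollobás a b P sizes cross =
  *-cancelʳ-≤ (length P) ((a + b) C a) (n ! * (a ! * b !)) {{m*n≢0 _ _ {{n !≢0}} {{a !* b !≢0}}}} (begin
    length P * (n ! * (a ! * b !)) ≡⟨ sym total ⟩
    ∑ (orderings n X) P * (a + b) !
      ≤⟨ *-monoˡ-≤ ((a + b) !) (∑-orderings-≤ n X P refl (All.tabulate λ p∈P x∈A → ⊆X p∈P (∈-++⁺ˡ x∈A)) cross) ⟩
    n ! * (a + b) ! ≡⟨ cong (n ! *_) (sym ([a+b]Ca*a!*b!≡[a+b]! a b)) ⟩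
    n ! * (((a + b) C a) * (a ! * b !)) ≡⟨ swap-factor (n !) ((a + b) C a) (a ! * b !) ⟩
    ((a + b) C a) * (n ! * (a ! * b !)) ∎)
  where
  open ≤-Reasoning
  X = deduplicate _≟_ (concat (map (λ p → proj₁ p ++ proj₂ p) P))
  n = length X
  swap-factor : ∀ x y z → x * (y * z) ≡ y * (x * z)
  swap-factor = solve-∀
  ⊆X : ∀ {p} → p ∈ P → proj₁ p ++ proj₂ p ⊆ X
  ⊆X p∈P x∈ = ∈-deduplicate⁺ _≟_ (∈-concat⁺′ x∈ (∈-map⁺ _ p∈P))
  count : ∀ {p} → p ∈ P → orderings n X p * (a + b) ! ≡ n ! * (a ! * b !)
  count {A , B} p∈P with ((uA , lA) , (uB , lB) , A∩B=∅) ← All.lookup sizes p∈P =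
    orderings-count n X A B A∩B=∅ refl a b
      (trans (∑χ-⊆ uA (deduplicate-! _) (λ x∈A → ⊆X p∈P (∈-++⁺ˡ x∈A))) lA)
      (trans (∑χ-⊆ uB (deduplicate-! _) (λ x∈B → ⊆X p∈P (∈-++⁺ʳ A x∈B))) lB)
  sum-const : ∀ {Q} → All (λ p → orderings n X p * (a + b) ! ≡ n ! * (a ! * b !)) Q →
    ∑ (orderings n X) Q * (a + b) ! ≡ length Q * (n ! * (a ! * b !))
  sum-const [] = refl
  sum-const {p ∷ Q} (eq ∷ eqs) =
    trans (*-distribʳ-+ ((a + b) !) (orderings n X p) _) (cong₂ _+_ eq (sum-const eqs))
  total : ∑ (orderings n X) P * (a + b) ! ≡ length P * (n ! * (a ! * b !))
  total = sum-const (All.tabulate count)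

-- Padding by fresh points.

∈⇒≤sum : ∀ {x} xs → x ∈ xs → x ≤ sum xs
∈⇒≤sum (x ∷ xs) (here refl) = m≤m+n x (sum xs)
∈⇒≤sum (x ∷ xs) (there x∈xs) = ≤-trans (∈⇒≤sum xs x∈xs) (m≤n+m (sum xs) x)

fresh : ∀ xs → ∃[ y ] y ∉ xs
fresh xs = suc (sum xs) , λ y∈xs → <-irrefl refl (∈⇒≤sum xs y∈xs)

pad : ∀ d T avoid → Unique T →
  ∃[ S ] IsKSet (d + length T) S × T ⊆ S × (∀ {x} → x ∈ S → x ∈ T ⊎ x ∉ avoid)
pad zero T avoid uT = T , (uT , refl) , id , inj₁
pad (suc d) T avoid uT
  with S , (uS , lS) , T⊆S , S⊆ ← pad d T avoid uT
  with y , y∉ ← fresh (S ++ avoid) =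
  y ∷ S
  , (All.tabulate (λ z∈S → λ { refl → y∉ (∈-++⁺ˡ z∈S) }) ∷ uS , cong suc lS)
  , there ∘ T⊆S
  , λ { (here refl) → inj₂ (y∉ ∘ ∈-++⁺ʳ S) ; (there x∈S) → S⊆ x∈S }

-- Blocking sets and critical subfamilies.

Blocks : FinSet → Family → Set
Blocks T G = All (Meets T) G

Blocks-⊆ : ∀ {S T G} → S ⊆ T → Blocks S G → Blocks T G
Blocks-⊆ S⊆T = All.map λ (x , x∈S , x∈B) → x , S⊆T x∈S , x∈B

-- `T` may be short and may repeat points, which makes it easy to add or remove a point; `extend`
-- recovers a genuine `t`-set.
Blockable : ℕ → Family → Set
Blockable t G = ∃[ T ] length T ≤ t × Blocks T G

-- With the points of a family as `avoid`, the added points create no new intersections with its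
-- blocks.
extend : ∀ {t} T avoid → length T ≤ t →
  ∃[ S ] IsKSet t S × T ⊆ S × (∀ {x} → x ∈ S → x ∈ T ⊎ x ∉ avoid)
extend {t} T avoid T≤t
  with S , (uS , lS) , T⊆S , S⊆ ← pad (t ∸ length (deduplicate _≟_ T)) (deduplicate _≟_ T) avoid (deduplicate-! T) =
  S
  , (uS , trans lS (m∸n+n≡m (≤-trans (length-deduplicate _≟_ T) T≤t)))
  , T⊆S ∘ ∈-deduplicate⁺ _≟_
  , [ inj₁ ∘ ∈-deduplicate⁻ _≟_ T , inj₂ ] ∘ S⊆

meets? : ∀ A B → Dec (Meets A B)
meets? A B = map′ find (λ (x , x∈A , x∈B) → lose x∈A x∈B) (any? (_∈? B) A)

infixl 6 _∖_
_∖_ : FinSet → ℕ → FinSet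
A ∖ x = filter (¬? ∘ (_≟ x)) A

∈-∖⁺ : ∀ {A x y} → y ∈ A → y ≢ x → y ∈ A ∖ x
∈-∖⁺ {x = x} = ∈-filter⁺ (¬? ∘ (_≟ x))

∈-∖⁻ : ∀ {A x y} → y ∈ A ∖ x → y ∈ A × y ≢ x
∈-∖⁻ {A} {x} = ∈-filter⁻ (¬? ∘ (_≟ x)) {xs = A}

length-∖ : ∀ {A x} → x ∈ A → length (A ∖ x) < length A
length-∖ {A} {x} x∈A = filter-notAll (¬? ∘ (_≟ x)) A (Any.map (λ { refl x≢x → x≢x refl }) x∈A)

KSet-∖ : ∀ {k A x} → IsKSet (suc k) A → x ∈ A → IsKSet k (A ∖ x)
KSet-∖ {k} {A} {x} (uA , lA) x∈A = Unique.filter⁺ _ uA , ≤-antisym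
  (s≤s⁻¹ (≤-trans (length-∖ x∈A) (≤-reflexive lA)))
  (s≤s⁻¹ (≤-trans (≤-reflexive (sym lA)) (Unique-⊆⇒length≤ uA A⊆)))
  where
  A⊆ : A ⊆ x ∷ (A ∖ x)
  A⊆ {y} y∈A with y ≟ x
  ... | yes y≡x = here y≡x
  ... | no y≢x = there (∈-∖⁺ y∈A y≢x)

-- A bounded search: a blocking set contains some point `a` of the first block, and its other
-- points, at most `t - 1` for budget `t`, must block the blocks that miss `a`. The decision
-- procedure makes the descent to a critical subfamily constructive.
blockable? : ∀ t G → Dec (Blockable t G)
blockable? t [] = yes ([] , z≤n , [])
blockable? zero (A ∷ G) = no λ { ([] , _ , (_ , () , _) ∷ _) }
blockable? (suc t) (A ∷ G) =
  map′ (from ∘ find) to (any? (λ a → blockable? t (filter (missing? a) G)) A)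
  where
  missing? : ∀ a B → Dec (a ∉ B)
  missing? a B = ¬? (a ∈? B)
  from : ∃[ a ] (a ∈ A × Blockable t (filter (missing? a) G)) → Blockable (suc t) (A ∷ G)
  from (a , a∈A , T , T≤t , b) = a ∷ T , s≤s T≤t , (a , here refl , a∈A) ∷ All.tabulate meets
    where
    meets : ∀ {B} → B ∈ G → Meets (a ∷ T) B
    meets {B} B∈G with a ∈? B
    ... | yes a∈B = a , here refl , a∈B
    ... | no a∉B with x , x∈T , x∈B ← All.lookup b (∈-filter⁺ (missing? a) B∈G a∉B) = x , there x∈T , x∈B
  to : Blockable (suc t) (A ∷ G) → Any (λ a → Blockable t (filter (missing? a) G)) A
  to (T , T≤ , (a , a∈T , a∈A) ∷ b) =
    lose a∈A (T ∖ a , s≤s⁻¹ (≤-trans (length-∖ a∈T) T≤) , All.tabulate meets)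
    where
    meets : ∀ {B} → B ∈ filter (missing? a) G → Meets (T ∖ a) B
    meets B∈ with B∈G , a∉B ← ∈-filter⁻ (missing? a) {xs = G} B∈
      with x , x∈T , x∈B ← All.lookup b B∈G = x , ∈-∖⁺ x∈T (λ { refl → a∉B x∈B }) , x∈B

Critical : ℕ → Family → Set
Critical t H = ¬ Blockable t H × (∀ i → Blockable t (removeAt H i))

-- Blocks are dropped one at a time as long as the rest stays unblockable; `n` bounds the length and
-- drives the recursion. Since positions are removed, a critical family cannot list a block twice:
-- the remaining copy would have to be blocked as well.
critical-subfamily : ∀ {t} n G → length G ≤ n → ¬ Blockable t G → ∃[ H ] H ⊆ G × Critical t H
critical-subfamily n [] _ ¬b = contradiction ([] , z≤n , []) ¬b
critical-subfamily {t} (suc n) G@(_ ∷ _) G≤n ¬b with Fin.all? (λ i → blockable? t (removeAt G i))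
... | yes all = G , id , ¬b , all
... | no ¬all with i , ¬bᵢ ← Fin.¬∀⟶∃¬ _ _ (λ i → blockable? t (removeAt G i)) ¬all
  with H , H⊆ , crit ← critical-subfamily n (removeAt G i)
         (≤-trans (≤-reflexive (length-removeAt G i)) (pred-mono-≤ G≤n)) ¬bᵢ =
  H , removeAt-⊆ G i ∘ H⊆ , crit

IsISP-AllPairs : ∀ {k t P} →
  All (λ p → IsKSet k (proj₁ p) × IsKSet t (proj₂ p)) P →
  All (λ p → Disjoint (proj₁ p) (proj₂ p)) P → AllPairs Cross P → IsISP k t P
IsISP-AllPairs {P = P} sizes disj cross = sizes , λ i j → mk⇔ (to i j) λ { refl → All.lookup disj (∈-lookup i) }
  where
  to : ∀ i j → Disjoint (proj₁ (lookup P i)) (proj₂ (lookup P j)) → i ≡ j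
  to i j d = decidable-stable (i Fin.≟ j) λ i≢j →
    d (proj₁ (AllPairs-lookup {R = Cross} swap cross i≢j))

-- `T i` blocks every block but the one at `i`. It must miss that one, or it would block all of `H`.
-- Padding outside the points of `H` preserves both facts.
critical⇒ISP : ∀ {k t} H → All (IsKSet k) H → Critical t H →
  ∃[ P ] IsISP k t P × concat H ⊆ concat (map (λ p → proj₁ p ++ proj₂ p) P)
critical⇒ISP {k} {t} H sizes (¬b , b) = tabulate f
  , IsISP-AllPairs
      (All.tabulate⁺ λ i → All.lookup sizes (∈-lookup i) , proj₁ (proj₂ (S i)))
      (All.tabulate⁺ disjoint)
      (AllPairs.tabulate⁺ λ {i} {j} i≢j → cross i j i≢j , cross j i (i≢j ∘ sym))
  , λ x∈ → let C , x∈C , C∈H = ∈-concat⁻′ H x∈ in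
      ∈-concat⁺′ (∈-++⁺ˡ (subst (_ ∈_) (Any.lookup-index C∈H) x∈C)) (∈-map⁺ _ (∈-tabulate⁺ (index C∈H)))
  where
  T : Fin (length H) → FinSet
  T i = proj₁ (b i)
  T-blocks : ∀ i → Blocks (T i) (removeAt H i)
  T-blocks i = proj₂ (proj₂ (b i))
  S : ∀ i → ∃[ S ] IsKSet t S × T i ⊆ S × (∀ {x} → x ∈ S → x ∈ T i ⊎ x ∉ concat H)
  S i = extend (T i) (concat H) (proj₁ (proj₂ (b i)))
  f : Fin (length H) → FinSet × FinSet
  f i = lookup H i , proj₁ (S i)
  disjoint : ∀ i → Disjoint (lookup H i) (proj₁ (S i))
  disjoint i (x , x∈A , x∈S) with proj₂ (proj₂ (proj₂ (S i))) x∈S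
  ... | inj₂ x∉H = x∉H (∈-concat⁺′ x∈A (∈-lookup {xs = H} i))
  ... | inj₁ x∈T = ¬b (T i , proj₁ (proj₂ (b i)) , All.tabulate meets)
    where
    meets : ∀ {C} → C ∈ H → Meets (T i) C
    meets C∈H with i Fin.≟ index C∈H
    ... | yes refl = x , x∈T , subst (x ∈_) (sym (Any.lookup-index C∈H)) x∈A
    ... | no i≢j = All.lookup (T-blocks i)
      (subst (_∈ removeAt H i) (sym (Any.lookup-index C∈H)) (∈-removeAt H i _ i≢j))
  cross : ∀ i j → i ≢ j → Meets (lookup H i) (proj₁ (S j))
  cross i j i≢j with x , x∈T , x∈A ← All.lookup (T-blocks j) (∈-removeAt H j i (i≢j ∘ sym)) =
    x , x∈A , proj₁ (proj₂ (proj₂ (S j))) x∈T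

-- A blocking set with fewer than k points extends by fresh points to a k-set, which maximality
-- puts in F although its fresh points lie in no block.
MIF-not-blockable : ∀ {k F j} → IsMIF k F → j < k → ¬ Blockable j F
MIF-not-blockable {k} {F} {j} (sizes , _ , maximal) j<k (T , T≤j , b)
  with S , (uS , lS) , T⊆S , S⊆ ← extend T (concat F) (≤-trans T≤j (<⇒≤ j<k))
  with B , B∈F , S⊆B , _ ← find (maximal S (uS , lS) (All.lookup (Blocks-⊆ T⊆S b))) =
  <⇒≱ j<k (≤-trans (≤-reflexive (sym lS)) (≤-trans (Unique-⊆⇒length≤ uS S⊆T) T≤j))
  where
  S⊆T : S ⊆ T
  S⊆T x∈S with S⊆ x∈S
  ... | inj₁ x∈T = x∈T
  ... | inj₂ x∉F = contradiction (∈-concat⁺′ (S⊆B x∈S) B∈F) x∉F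

-- Points outside the critical subfamily.

module _ {t F H} (mif : IsMIF (2 + t) F) (H⊆F : H ⊆ F) (¬b : ¬ Blockable t H) where

  private
    sizes : ∀ {A} → A ∈ F → IsKSet (2 + t) A
    sizes = All.lookup (proj₁ mif)

  -- If a block had two points x, y outside ⋃ H, removing them would leave a t-set blocking H.
  one-outside : ∀ {A x y} → A ∈ F → x ∈ A → y ∈ A → x ∉ concat H → y ∉ concat H → x ≡ y
  one-outside {A} {x} {y} A∈F x∈A y∈A x∉ y∉ = decidable-stable (x ≟ y) λ x≢y →
    ¬b (A ∖ x ∖ y
       , ≤-reflexive (proj₂ (KSet-∖ (KSet-∖ (sizes A∈F) x∈A) (∈-∖⁺ y∈A (x≢y ∘ sym))))
       , All.tabulate λ C∈H → let z , z∈A , z∈C = proj₁ (proj₂ mif) A∈F (H⊆F C∈H) in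
           z , ∈-∖⁺ (∈-∖⁺ z∈A λ { refl → x∉ (∈-concat⁺′ z∈C C∈H) }) (λ { refl → y∉ (∈-concat⁺′ z∈C C∈H) }) , z∈C)

  -- A common point of `A` and `B` survives both removals: if it were `x`, then `B` would contain
  -- two distinct points `x` and `y` outside the points of `H`, and symmetrically for `y` and `A`.
  meets-outside : ∀ {A B x y} → A ∈ F → B ∈ F → x ∈ A → y ∈ B →
    x ∉ concat H → y ∉ concat H → x ≢ y → Meets (A ∖ x) (B ∖ y)
  meets-outside A∈F B∈F x∈A y∈B x∉ y∉ x≢y with z , z∈A , z∈B ← proj₁ (proj₂ mif) A∈F B∈F =
    z , ∈-∖⁺ z∈A (λ { refl → x≢y (one-outside B∈F z∈B y∈B x∉ y∉) })
      , ∈-∖⁺ z∈B (λ { refl → x≢y (one-outside A∈F x∈A z∈A x∉ y∉) })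

  -- Needed for a pair to cross its own swap; `A ∖ x` has `suc t` points and so is nonempty.
  meets-self : ∀ {A x} → A ∈ F → x ∈ A → Meets (A ∖ x) (A ∖ x)
  meets-self {A} {x} A∈F x∈A with A ∖ x | proj₂ (KSet-∖ (sizes A∈F) x∈A)
  ... | y ∷ _ | _ = y , here refl , here refl

  Through : ℕ → FinSet × FinSet → Set
  Through x (A , B) = A ∈ F × B ∈ F × x ∈ A × x ∈ B × Disjoint (A ∖ x) (B ∖ x)

  separate : ∀ {A x} → A ∈ F → x ∈ A → ∃[ B ] (B ∈ F × ¬ Meets (A ∖ x) B)
  separate {A} {x} A∈F x∈A = find (All.¬All⇒Any¬ (meets? (A ∖ x)) F not-blocks)
    where
    not-blocks : ¬ Blocks (A ∖ x) F
    not-blocks b = MIF-not-blockable mif ≤-refl (A ∖ x , ≤-reflexive (proj₂ (KSet-∖ (sizes A∈F) x∈A)) , b)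

  abstract
    through : ∀ {x} → x ∈ concat F → ∃[ p ] Through x p
    through {x} x∈F =
      let A , x∈A , A∈F = ∈-concat⁻′ F x∈F
          B , B∈F , ¬m = separate A∈F x∈A
          z , z∈A , z∈B = proj₁ (proj₂ mif) A∈F B∈F
          z≡x = decidable-stable (z ≟ x) (λ z≢x → ¬m (z , ∈-∖⁺ z∈A z≢x , z∈B))
      in (A , B) , A∈F , B∈F , x∈A , subst (_∈ B) z≡x z∈B ,
         λ (y , y∈A , y∈B) → ¬m (y , y∈A , proj₁ (∈-∖⁻ y∈B))

  -- Each outside point contributes a pair and its swap, which doubles the count and yields the
  -- factor one half in the final bound.
  outside-bound : ∀ {O} → Unique O → All (_∈ concat F) O → All (_∉ concat H) O →
    length O + length O ≤ (suc t + suc t) C suc t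
  outside-bound {O} uO O⊆ O∉ = ≤-trans (≤-reflexive (sym lenQ)) (bollobás (suc t) (suc t) Q
    (All.++⁺ (All.tabulate⁺ λ i → sizeᴬ i , sizeᴮ i , disjoint i)
             (All.tabulate⁺ λ i → sizeᴮ i , sizeᴬ i , λ (y , y∈B , y∈A) → disjoint i (y , y∈A , y∈B)))
    (AllPairs.++⁺
      (AllPairs.tabulate⁺ λ {i} {j} i≢j → AB i j i≢j , AB j i (i≢j ∘ sym))
      (AllPairs.tabulate⁺ λ {i} {j} i≢j → BA i j i≢j , BA j i (i≢j ∘ sym))
      -- A pair against a swapped pair compares first with first and second with second set; here
      -- `i` and `j` may coincide.
      (All.tabulate⁺ λ i → All.tabulate⁺ λ j → AA i j , BB j i)))
    where
    I = Fin (length O)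
    pt : I → ℕ
    pt = lookup O
    thr : ∀ i → ∃[ p ] Through (pt i) p
    thr i = through (All.lookup O⊆ (∈-lookup i))
    A B : I → FinSet
    A i = proj₁ (proj₁ (thr i))
    B i = proj₂ (proj₁ (thr i))
    A∈F : ∀ i → A i ∈ F
    A∈F i = proj₁ (proj₂ (thr i))
    B∈F : ∀ i → B i ∈ F
    B∈F i = proj₁ (proj₂ (proj₂ (thr i)))
    ∈A : ∀ i → pt i ∈ A i
    ∈A i = proj₁ (proj₂ (proj₂ (proj₂ (thr i))))
    ∈B : ∀ i → pt i ∈ B i
    ∈B i = proj₁ (proj₂ (proj₂ (proj₂ (proj₂ (thr i)))))
    disjoint : ∀ i → Disjoint (A i ∖ pt i) (B i ∖ pt i)
    disjoint i = proj₂ (proj₂ (proj₂ (proj₂ (proj₂ (thr i)))))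
    f : I → FinSet × FinSet
    f i = A i ∖ pt i , B i ∖ pt i
    Q = tabulate f ++ tabulate (swap ∘ f)
    lenQ : length Q ≡ length O + length O
    lenQ = trans (length-++ (tabulate f)) (cong₂ _+_ (length-tabulate f) (length-tabulate (swap ∘ f)))
    sizeᴬ : ∀ i → IsKSet (suc t) (A i ∖ pt i)
    sizeᴬ i = KSet-∖ (sizes (A∈F i)) (∈A i)
    sizeᴮ : ∀ i → IsKSet (suc t) (B i ∖ pt i)
    sizeᴮ i = KSet-∖ (sizes (B∈F i)) (∈B i)
    meets : ∀ {C D} i j → i ≢ j → C ∈ F → D ∈ F → pt i ∈ C → pt j ∈ D → Meets (C ∖ pt i) (D ∖ pt j)
    meets i j i≢j C∈F D∈F i∈C j∈D = meets-outside C∈F D∈F i∈C j∈D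
      (All.lookup O∉ (∈-lookup i)) (All.lookup O∉ (∈-lookup j)) (AllPairs-lookup (_∘ sym) uO i≢j)
    AB : ∀ i j → i ≢ j → Meets (A i ∖ pt i) (B j ∖ pt j)
    AB i j i≢j = meets i j i≢j (A∈F i) (B∈F j) (∈A i) (∈B j)
    BA : ∀ i j → i ≢ j → Meets (B i ∖ pt i) (A j ∖ pt j)
    BA i j i≢j = meets i j i≢j (B∈F i) (A∈F j) (∈B i) (∈A j)
    AA : ∀ i j → Meets (A i ∖ pt i) (A j ∖ pt j)
    AA i j with i Fin.≟ j
    ... | yes refl = meets-self (A∈F i) (∈A i)
    ... | no i≢j = meets i j i≢j (A∈F i) (A∈F j) (∈A i) (∈A j)
    BB : ∀ i j → Meets (B i ∖ pt i) (B j ∖ pt j)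
    BB i j with i Fin.≟ j
    ... | yes refl = meets-self (B∈F i) (∈B i)
    ... | no i≢j = meets i j i≢j (B∈F i) (B∈F j) (∈B i) (∈B j)

-- The maximum `n(k, k - 2)` enters as an arbitrary upper bound `m`, and the inequality is doubled
-- to clear the fraction.
theorem2p7 : ∀ (k : ℕ) → 2 ≤ k →
    ∀ (m : ℕ) → (∀ P → IsISP k (k ∸ 2) P → ispNumPoints P ≤ m) →
    ∀ F → IsMIF k F →
    2 * numPoints F ≤ ((2 * k ∸ 2) C (k ∸ 1)) + 2 * m
theorem2p7 (suc (suc t)) (s≤s (s≤s z≤n)) m ≤m F mif
  -- With `k = 2 + t`, a blocking set of at most `t` points is too small for `F`, so the descent can
  -- start from `F` itself.
  with H , H⊆F , crit ← critical-subfamily {t} (length F) F ≤-refl (MIF-not-blockable mif (m<n+m t (s≤s z≤n)))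
  with P , isp , H⊆P ← critical⇒ISP H (All.tabulate (All.lookup (proj₁ mif) ∘ H⊆F)) crit = begin
  2 * numPoints F ≤⟨ *-monoʳ-≤ 2 (Unique-⊆⇒length≤ (deduplicate-! (concat F)) split) ⟩
  2 * length (dP ++ O) ≡⟨ cong (2 *_) (length-++ dP) ⟩
  2 * (length dP + length O) ≡⟨ arrange (length dP) (length O) ⟩
  (length O + length O) + 2 * length dP ≤⟨ +-mono-≤ O-bound (*-monoʳ-≤ 2 (≤m P isp)) ⟩
  (suc t + suc t) C suc t + 2 * m ≡⟨ cong (λ n → n C suc t + 2 * m) (double t) ⟩
  (2 * suc (suc t) ∸ 2) C suc t + 2 * m ∎
  where
  open ≤-Reasoning
  outside? : Decidable (_∉ concat H)
  outside? x = ¬? (x ∈? concat H)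
  O = filter outside? (deduplicate _≟_ (concat F))
  dP = deduplicate _≟_ (concat (map (λ p → proj₁ p ++ proj₂ p) P))
  -- Points of `H` are already points of the set-pair system and are charged to `m`; the remaining
  -- ones form `O`.
  split : deduplicate _≟_ (concat F) ⊆ dP ++ O
  split {x} x∈F with x ∈? concat H
  ... | yes x∈H = ∈-++⁺ˡ (∈-deduplicate⁺ _≟_ (H⊆P x∈H))
  ... | no x∉H = ∈-++⁺ʳ dP (∈-filter⁺ outside? x∈F x∉H)
  O-bound : length O + length O ≤ (suc t + suc t) C suc t
  O-bound = outside-bound mif H⊆F (proj₁ crit) (Unique.filter⁺ outside? (deduplicate-! (concat F)))
    (All.filter⁺ outside? (All.tabulate (∈-deduplicate⁻ _≟_ (concat F))))
    (All.all-filter outside? (deduplicate _≟_ (concat F)))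
  arrange : ∀ a b → 2 * (a + b) ≡ b + b + 2 * a
  arrange = solve-∀
  double : ∀ t → suc t + suc t ≡ t + suc (suc (t + 0))
  double = solve-∀
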